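{- The following problem is undecidable: given a finite signature $\Sigma$ and a finite set $E$ of equations between $\Sigma$-terms, decide whether the monad $T$ on $\mathbf{Set}$ presented by $(\Sigma,E)$ is affine, i.e. whether $T1$ is a one-element set.
   Context: The monad presented by $(\Sigma,E)$ is the free-algebra monad: $TX$ is the carrier of the free $\Sigma$-algebra satisfying $E$ generated by $X$ (terms over $X$ modulo the congruence generated by substitution instances of $E$), $Tf$ substitutes $f(x)$ for $x$, $\eta$ sends a variable to itself, and $\mu$ flattens terms of terms. A monad is affine if $T1$ is terminal, i.e. a one-element set. -}

module Defs where

open import Data.Fin.Base using (Fin; toℕ)
open import Data.Fin.Properties using (toℕ-injective)
open import Data.List.Base as List using (List; []; _∷_)
open import Data.List.Membership.Propositional using (_∈_)
open import Data.Nat.Base using (ℕ; zero; suc; _+_; _*_; _^_; _<_)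
open import Data.Nat.Properties
  using (*-assoc; *-identityˡ; *-cancelˡ-≡; even≢odd; suc-injective)
open import Data.Product.Base using (Σ-syntax; ∃; _×_; _,_; proj₁; proj₂)
open import Data.Unit.Base using (⊤)
open import Data.Vec.Base as Vec using (Vec; []; _∷_)
open import Data.Vec.Relation.Binary.Pointwise.Inductive
  using (Pointwise; []; _∷_)
open import Function.Base using (id; _∘_)
open import Function.Bundles using (Func; _⟨$⟩_)
open import Function.Construct.Composition using (function)
import Function.Construct.Identity as Identity
open import Function.Definitions using (Injective)
open import Level using (0ℓ)
open import Relation.Binary.Bundles using (Setoid)
open import Relation.Binary.PropositionalEquality as ≡
  using (_≡_; refl; sym; trans; cong; cong₂)
open import Relation.Nullary.Negation.Core using (¬_; contradiction)

------------------------------------------------------------------------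
-- Monads on sets
--
-- Quotients are represented by setoids, so the category of sets is
-- represented by setoids and equality-preserving functions.

SET : Set₁
SET = Setoid 0ℓ 0ℓ

infix 4 _≐_

_≐_ : {X Y : SET} → Func X Y → Func X Y → Set
_≐_ {X} {Y} f g = ∀ x → Setoid._≈_ Y (f ⟨$⟩ x) (g ⟨$⟩ x)

infixr 9 _⊙_

_⊙_ : {X Y Z : SET} → Func Y Z → Func X Y → Func X Z
g ⊙ f = function f g

idᶠ : (X : SET) → Func X X
idᶠ = Identity.function

record Monad : Set₁ where
  field
    T₀ : SET → SET
    T₁ : {X Y : SET} → Func X Y → Func (T₀ X) (T₀ Y)
    η  : (X : SET) → Func X (T₀ X)
    μ  : (X : SET) → Func (T₀ (T₀ X)) (T₀ X)

    T-resp-≐   : {X Y : SET} {f g : Func X Y} → f ≐ g → T₁ f ≐ T₁ g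
    T-identity : (X : SET) → T₁ (idᶠ X) ≐ idᶠ (T₀ X)
    T-compose  : {X Y Z : SET} (g : Func Y Z) (f : Func X Y) →
                 T₁ (g ⊙ f) ≐ T₁ g ⊙ T₁ f
    η-natural  : {X Y : SET} (f : Func X Y) → T₁ f ⊙ η X ≐ η Y ⊙ f
    μ-natural  : {X Y : SET} (f : Func X Y) →
                 T₁ f ⊙ μ X ≐ μ Y ⊙ T₁ (T₁ f)
    μ-η        : (X : SET) → μ X ⊙ η (T₀ X) ≐ idᶠ (T₀ X)
    μ-Tη       : (X : SET) → μ X ⊙ T₁ (η X) ≐ idᶠ (T₀ X)
    μ-μ        : (X : SET) → μ X ⊙ T₁ (μ X) ≐ μ X ⊙ μ (T₀ X)

IsOneElement : SET → Set
IsOneElement X = Σ[ x ∈ Carrier ] (∀ y → y ≈ x)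
  where open Setoid X

𝟙 : SET
𝟙 = ≡.setoid ⊤

IsAffine : Monad → Set
IsAffine T = IsOneElement (Monad.T₀ T 𝟙)

------------------------------------------------------------------------
-- Finite presentations

-- A finite signature is the list of the arities of its symbols.
Signature : Set
Signature = List ℕ

Symbol : Signature → Set
Symbol S = Fin (List.length S)

arity : (S : Signature) → Symbol S → ℕ
arity = List.lookup

data Term (S : Signature) (X : Set) : Set where
  var : X → Term S X
  op  : (f : Symbol S) → Vec (Term S X) (arity S f) → Term S X

Equation : Signature → Set
Equation S = Term S ℕ × Term S ℕ

record Presentation : Set where
  constructor ⟨_∣_⟩
  field
    signature : Signature
    equations : List (Equation signature)

------------------------------------------------------------------------
-- Substitution

module _ {S : Signature} where

  mutual
    sub : {X Y : Set} → (X → Term S Y) → Term S X → Term S Y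
    sub σ (var x)   = σ x
    sub σ (op f ts) = op f (subs σ ts)

    -- Vec.map (sub σ), inlined for the termination checker.
    subs : {X Y : Set} {n : ℕ} →
           (X → Term S Y) → Vec (Term S X) n → Vec (Term S Y) n
    subs σ []       = []
    subs σ (t ∷ ts) = sub σ t ∷ subs σ ts

  mutual
    sub-sub : {X Y Z : Set} (τ : Y → Term S Z) (σ : X → Term S Y)
              (t : Term S X) → sub τ (sub σ t) ≡ sub (sub τ ∘ σ) t
    sub-sub τ σ (var x)   = refl
    sub-sub τ σ (op f ts) = cong (op f) (subs-subs τ σ ts)

    subs-subs : {X Y Z : Set} {n : ℕ} (τ : Y → Term S Z) (σ : X → Term S Y)
                (ts : Vec (Term S X) n) →
                subs τ (subs σ ts) ≡ subs (sub τ ∘ σ) ts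
    subs-subs τ σ []       = refl
    subs-subs τ σ (t ∷ ts) = cong₂ _∷_ (sub-sub τ σ t) (subs-subs τ σ ts)

  mutual
    sub-var : {X : Set} (t : Term S X) → sub var t ≡ t
    sub-var (var x)   = refl
    sub-var (op f ts) = cong (op f) (subs-var ts)

    subs-var : {X : Set} {n : ℕ} (ts : Vec (Term S X) n) → subs var ts ≡ ts
    subs-var []       = refl
    subs-var (t ∷ ts) = cong₂ _∷_ (sub-var t) (subs-var ts)

------------------------------------------------------------------------
-- The monad presented by a finite presentation

module _ (P : Presentation) where
  open Presentation P renaming (signature to S; equations to E)

  module _ (X : SET) where
    open Setoid X using (Carrier) renaming (_≈_ to _≈ˣ_)

    infix 4 _≋_

    data _≋_ : Term S Carrier → Term S Carrier → Set where
      ≋-var   : ∀ {x y} → x ≈ˣ y → var x ≋ var y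
      ≋-op    : ∀ f {ts us} → Pointwise _≋_ ts us → op f ts ≋ op f us
      ≋-ax    : ∀ {l r} → (l , r) ∈ E → (σ : ℕ → Term S Carrier) →
                sub σ l ≋ sub σ r
      ≋-refl  : ∀ {t} → t ≋ t
      ≋-sym   : ∀ {t u} → t ≋ u → u ≋ t
      ≋-trans : ∀ {t u v} → t ≋ u → u ≋ v → t ≋ v

  Free : SET → SET
  Free X = record
    { Carrier       = Term S (Setoid.Carrier X)
    ; _≈_           = _≋_ X
    ; isEquivalence = record
      { refl = ≋-refl ; sym = ≋-sym ; trans = ≋-trans }
    }

  ≋-reflexive : (X : SET) {t u : Term S (Setoid.Carrier X)} →
                t ≡ u → _≋_ X t u
  ≋-reflexive X = Setoid.reflexive (Free X)

  mutual
    sub-pointwise : {A : Set} (Y : SET) {σ τ : A → Term S (Setoid.Carrier Y)} →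
                    (∀ x → _≋_ Y (σ x) (τ x)) →
                    ∀ t → _≋_ Y (sub σ t) (sub τ t)
    sub-pointwise Y σ≋τ (var x)   = σ≋τ x
    sub-pointwise Y σ≋τ (op f ts) = ≋-op f (subs-pointwise Y σ≋τ ts)

    subs-pointwise : {A : Set} {n : ℕ} (Y : SET)
                     {σ τ : A → Term S (Setoid.Carrier Y)} →
                     (∀ x → _≋_ Y (σ x) (τ x)) →
                     (ts : Vec (Term S A) n) →
                     Pointwise (_≋_ Y) (subs σ ts) (subs τ ts)
    subs-pointwise Y σ≋τ []       = []
    subs-pointwise Y σ≋τ (t ∷ ts) =
      sub-pointwise Y σ≋τ t ∷ subs-pointwise Y σ≋τ ts

  module _ {X Y : SET} (σ : Func X (Free Y)) where
    mutual
      sub-cong : ∀ {t u} → _≋_ X t u →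
                 _≋_ Y (sub (σ ⟨$⟩_) t) (sub (σ ⟨$⟩_) u)
      sub-cong (≋-var x≈y)      = Func.cong σ x≈y
      sub-cong (≋-op f ts≋us)   = ≋-op f (subs-cong ts≋us)
      sub-cong (≋-ax {l} {r} l≈r ρ) =
        ≋-trans (≋-reflexive Y (sub-sub (σ ⟨$⟩_) ρ l))
        (≋-trans (≋-ax l≈r (sub (σ ⟨$⟩_) ∘ ρ))
                 (≋-reflexive Y (sym (sub-sub (σ ⟨$⟩_) ρ r))))
      sub-cong ≋-refl           = ≋-refl
      sub-cong (≋-sym p)        = ≋-sym (sub-cong p)
      sub-cong (≋-trans p q)    = ≋-trans (sub-cong p) (sub-cong q)

      subs-cong : ∀ {m n} {ts : Vec (Term S (Setoid.Carrier X)) m}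
                  {us : Vec (Term S (Setoid.Carrier X)) n} →
                  Pointwise (_≋_ X) ts us →
                  Pointwise (_≋_ Y) (subs (σ ⟨$⟩_) ts) (subs (σ ⟨$⟩_) us)
      subs-cong []       = []
      subs-cong (p ∷ ps) = sub-cong p ∷ subs-cong ps

  unit : (X : SET) → Func X (Free X)
  unit X = record { to = var ; cong = ≋-var }

  extend : {X Y : SET} → Func X (Free Y) → Func (Free X) (Free Y)
  extend σ = record { to = sub (σ ⟨$⟩_) ; cong = sub-cong σ }

  flatten : (X : SET) → Func (Free (Free X)) (Free X)
  flatten X = extend (idᶠ (Free X))

  rename : {X Y : SET} → Func X Y → Func (Free X) (Free Y)
  rename {Y = Y} f = extend (unit Y ⊙ f)

  presentedMonad : Monad
  presentedMonad = record
    { T₀         = Free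
    ; T₁         = rename
    ; η          = unit
    ; μ          = flatten
    ; T-resp-≐   = λ {_} {Y} f≐g → sub-pointwise Y (≋-var ∘ f≐g)
    ; T-identity = λ X t → ≋-reflexive X (sub-var t)
    ; T-compose  = λ {_} {_} {Z} g f t → ≋-reflexive Z (sym (sub-sub _ _ t))
    ; η-natural  = λ f x → ≋-refl
    ; μ-natural  = λ {_} {Y} f t →
        ≋-reflexive Y (trans (sub-sub _ _ t) (sym (sub-sub _ _ t)))
    ; μ-η        = λ X t → ≋-refl
    ; μ-Tη       = λ X t → ≋-reflexive X (trans (sub-sub _ _ t) (sub-var t))
    ; μ-μ        = λ X t →
        ≋-reflexive X (trans (sub-sub _ _ t) (sym (sub-sub _ _ t)))
    }

------------------------------------------------------------------------
-- Partial recursive functions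

data Rec : ℕ → Set where
  zeroʳ : ∀ {n} → Rec n
  sucʳ  : Rec 1
  projʳ : ∀ {n} → Fin n → Rec n
  compʳ : ∀ {m n} → Rec m → Vec (Rec n) m → Rec n
  primʳ : ∀ {n} → Rec n → Rec (2 + n) → Rec (1 + n)
  minʳ  : ∀ {n} → Rec (1 + n) → Rec n

infix 4 _[_]⇓_

-- f [ xs ]⇓ y: the function described by f is defined at xs, with value y.
data _[_]⇓_ : ∀ {n} → Rec n → Vec ℕ n → ℕ → Set where
  ⇓-zero : ∀ {n} {xs : Vec ℕ n} → zeroʳ [ xs ]⇓ 0
  ⇓-suc  : ∀ {x} → sucʳ [ x ∷ [] ]⇓ suc x
  ⇓-proj : ∀ {n} {i : Fin n} {xs} → projʳ i [ xs ]⇓ Vec.lookup xs i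
  ⇓-comp : ∀ {m n} {f : Rec m} {gs : Vec (Rec n) m} {xs ys z} →
           Pointwise (λ g y → g [ xs ]⇓ y) gs ys → f [ ys ]⇓ z →
           compʳ f gs [ xs ]⇓ z
  ⇓-base : ∀ {n} {f : Rec n} {g xs y} → f [ xs ]⇓ y →
           primʳ f g [ 0 ∷ xs ]⇓ y
  ⇓-step : ∀ {n} {f : Rec n} {g xs k y z} → primʳ f g [ k ∷ xs ]⇓ y →
           g [ k ∷ y ∷ xs ]⇓ z → primʳ f g [ suc k ∷ xs ]⇓ z
  ⇓-min  : ∀ {n} {f : Rec (1 + n)} {xs k} →
           (∀ j → j < k → ∃ λ y → f [ j ∷ xs ]⇓ suc y) →
           f [ k ∷ xs ]⇓ 0 → minʳ f [ xs ]⇓ k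

-- The algorithm is only required to give an answer on codes of instances.
Decides : {A : Set} → (A → ℕ) → Rec 1 → (A → Set) → Set
Decides code f P =
  ∀ a → (P a → f [ code a ∷ [] ]⇓ 1) × (¬ P a → f [ code a ∷ [] ]⇓ 0)

Undecidable : {A : Set} → (A → ℕ) → (A → Set) → Set
Undecidable code P = ¬ (∃ λ f → Decides code f P)

------------------------------------------------------------------------
-- Gödel numbering of finite presentations

-- A bijection from ℕ × ℕ to the positive integers; 0 codes the empty list.
pair : ℕ → ℕ → ℕ
pair a b = 2 ^ a * suc (2 * b)

codeList : {A : Set} → (A → ℕ) → List A → ℕ
codeList c []       = 0
codeList c (x ∷ xs) = pair (c x) (codeList c xs)

module _ {S : Signature} where

  mutual
    codeTerm : Term S ℕ → ℕ
    codeTerm (var x)   = pair 0 x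
    codeTerm (op f ts) = pair (suc (toℕ f)) (codeTerms ts)

    codeTerms : ∀ {n} → Vec (Term S ℕ) n → ℕ
    codeTerms []       = 0
    codeTerms (t ∷ ts) = pair (codeTerm t) (codeTerms ts)

  codeEquation : Equation S → ℕ
  codeEquation (l , r) = pair (codeTerm l) (codeTerm r)

codePresentation : Presentation → ℕ
codePresentation ⟨ S ∣ E ⟩ = pair (codeList id S) (codeList codeEquation E)

------------------------------------------------------------------------
-- Distinct presentations have distinct codes

private
  pair-suc : ∀ a b → pair (suc a) b ≡ 2 * pair a b
  pair-suc a b = *-assoc 2 (2 ^ a) (suc (2 * b))

  pair-zero : ∀ b → pair 0 b ≡ suc (2 * b)
  pair-zero b = *-identityˡ (suc (2 * b))

pair-injective : ∀ a b a′ b′ → pair a b ≡ pair a′ b′ → a ≡ a′ × b ≡ b′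
pair-injective zero b zero b′ eq =
  refl , *-cancelˡ-≡ b b′ 2
    (suc-injective (trans (sym (pair-zero b)) (trans eq (pair-zero b′))))
pair-injective zero b (suc a′) b′ eq =
  contradiction (trans (sym (pair-suc a′ b′)) (trans (sym eq) (pair-zero b)))
    (even≢odd (pair a′ b′) b)
pair-injective (suc a) b zero b′ eq =
  contradiction (trans (sym (pair-suc a b)) (trans eq (pair-zero b′)))
    (even≢odd (pair a b) b′)
pair-injective (suc a) b (suc a′) b′ eq
  with a≡a′ , b≡b′ ← pair-injective a b a′ b′
         (*-cancelˡ-≡ (pair a b) (pair a′ b′) 2
           (trans (sym (pair-suc a b)) (trans eq (pair-suc a′ b′))))
  = cong suc a≡a′ , b≡b′

pair≢0 : ∀ a b → ¬ (pair a b ≡ 0)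
pair≢0 zero    b ()
pair≢0 (suc a) b eq =
  pair≢0 a b (*-cancelˡ-≡ (pair a b) 0 2 (trans (sym (pair-suc a b)) eq))

codeList-injective : {A : Set} (c : A → ℕ) → Injective _≡_ _≡_ c →
                     Injective _≡_ _≡_ (codeList c)
codeList-injective c inj {[]}     {[]}     eq = refl
codeList-injective c inj {[]}     {y ∷ ys} eq =
  contradiction (sym eq) (pair≢0 (c y) (codeList c ys))
codeList-injective c inj {x ∷ xs} {[]}     eq =
  contradiction eq (pair≢0 (c x) (codeList c xs))
codeList-injective c inj {x ∷ xs} {y ∷ ys} eq
  with cx≡cy , cxs≡cys ←
    pair-injective (c x) (codeList c xs) (c y) (codeList c ys) eq
  = cong₂ _∷_ (inj cx≡cy) (codeList-injective c inj cxs≡cys)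

module _ {S : Signature} where

  mutual
    codeTerm-injective : (t u : Term S ℕ) → codeTerm t ≡ codeTerm u → t ≡ u
    codeTerm-injective (var x)   (var y)   eq =
      cong var (proj₂ (pair-injective 0 x 0 y eq))
    codeTerm-injective (var x)   (op g us) eq
      with () ← proj₁ (pair-injective 0 x (suc (toℕ g)) (codeTerms us) eq)
    codeTerm-injective (op f ts) (var y)   eq
      with () ← proj₁ (pair-injective (suc (toℕ f)) (codeTerms ts) 0 y eq)
    codeTerm-injective (op f ts) (op g us) eq
      with sf≡sg , cts≡cus ←
        pair-injective (suc (toℕ f)) (codeTerms ts)
                       (suc (toℕ g)) (codeTerms us) eq
      with refl ← toℕ-injective (suc-injective sf≡sg)
      = cong (op f) (codeTerms-injective ts us cts≡cus)

    codeTerms-injective : ∀ {n} (ts us : Vec (Term S ℕ) n) →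
                          codeTerms ts ≡ codeTerms us → ts ≡ us
    codeTerms-injective []       []       eq = refl
    codeTerms-injective (t ∷ ts) (u ∷ us) eq
      with ct≡cu , cts≡cus ←
        pair-injective (codeTerm t) (codeTerms ts)
                       (codeTerm u) (codeTerms us) eq
      = cong₂ _∷_ (codeTerm-injective t u ct≡cu)
                  (codeTerms-injective ts us cts≡cus)

  codeEquation-injective : Injective _≡_ _≡_ (codeEquation {S})
  codeEquation-injective {l , r} {l′ , r′} eq
    with cl≡cl′ , cr≡cr′ ←
      pair-injective (codeTerm l) (codeTerm r) (codeTerm l′) (codeTerm r′) eq
    = cong₂ _,_ (codeTerm-injective l l′ cl≡cl′)
                (codeTerm-injective r r′ cr≡cr′)

codePresentation-injective : Injective _≡_ _≡_ codePresentation
codePresentation-injective {⟨ S ∣ E ⟩} {⟨ S′ ∣ E′ ⟩} eq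
  with cS≡cS′ , cE≡cE′ ←
    pair-injective (codeList id S) (codeList codeEquation E)
                   (codeList id S′) (codeList codeEquation E′) eq
  with refl ← codeList-injective id id {S} {S′} cS≡cS′
  = cong ⟨ S ∣_⟩ (codeList-injective codeEquation codeEquation-injective cE≡cE′)

module Submission where

-- A Horn program becomes a finite presentation: an implication operation with
-- true ⊃ x = x turns every clause into an equation, and the extra equation
-- holds goal ⊃ x = true makes all terms equal as soon as the goal is derivable.
-- Conversely, a set of ground atoms closed under the clauses that misses the goal
-- gives a nontrivial model on predicates over ground terms. A fixed Horn program
-- evaluates partial recursive functions, so for every f there is a presentation
-- that is affine if f (n) = 0 and not affine if f (n) = 1. If f is a decision
-- procedure composed with the map from the code of a program to the code of its
-- presentation, and n is the code of f itself, the answer is wrong.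

open import Data.Empty using (⊥)
open import Data.Fin.Base using (Fin; zero; suc; toℕ)
open import Data.Fin.Patterns using (0F; 1F; 2F; 3F; 4F; 5F)
open import Data.List.Base as List using (List; []; _∷_; _++_)
open import Data.List.Membership.Propositional using (_∈_)
open import Data.List.Membership.Propositional.Properties using (∈-map⁺)
open import Data.List.Properties using (map-++)
open import Data.List.Relation.Unary.All as All using (All; []; _∷_)
import Data.List.Relation.Unary.All.Properties as All
open import Data.List.Relation.Unary.Any using (here; there)
open import Data.Nat.Base using (ℕ; zero; suc; _+_; _*_; _^_; _<_; s≤s)
open import Data.Nat.Properties
  using (*-assoc; *-identityˡ; *-suc; +-suc; +-identityʳ; m≤n+m)
open import Data.Product.Base using (∃; ∃₂; _×_; _,_; proj₁; proj₂)
open import Data.Unit.Base using (⊤; tt)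
open import Data.Vec.Base as Vec using (Vec; []; _∷_)
open import Data.Vec.Properties using (lookup∘tabulate)
open import Data.Vec.Relation.Binary.Pointwise.Inductive
  as Pointwise using (Pointwise; []; _∷_)
open import Function.Base using (_∘_; id)
open import Level using (0ℓ)
open import Relation.Binary.PropositionalEquality
  using (_≡_; refl; sym; trans; cong; cong₂; subst)
open import Relation.Nullary.Negation.Core using (¬_; contradiction)
open import Relation.Unary using (Pred; U; ｛_｝) renaming (_≐_ to _≗ₚ_)
open import Relation.Unary.Properties using (≐-refl; ≐-sym; ≐-trans)

open import Defs

-- Horn clauses over binary trees

data Tree (V : Set) : Set where
  var  : V → Tree V
  leaf : Tree V
  node : Tree V → Tree V → Tree V

GroundTree : Set
GroundTree = Tree ⊥

inst : {V W : Set} → (V → Tree W) → Tree V → Tree W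
inst σ (var v)    = σ v
inst σ leaf       = leaf
inst σ (node a b) = node (inst σ a) (inst σ b)

record Clause : Set where
  constructor clause
  field
    vars  : ℕ
    hyps  : List (Tree (Fin vars))
    concl : Tree (Fin vars)

-- Instances are vectors, so that proofs can match on the variables of a clause or leave them to
-- unification.
_RespectsClause_ : Pred GroundTree 0ℓ → Clause → Set
M RespectsClause clause k hs c = ∀ (σ : Vec GroundTree k) →
  All M (List.map (inst (Vec.lookup σ)) hs) → M (inst (Vec.lookup σ) c)

-- Horn clauses as equations

Sig : Signature
Sig = 0 ∷ 2 ∷ 0 ∷ 2 ∷ 1 ∷ 1 ∷ []

module _ {X : Set} where

  leafᵗ true : Term Sig X
  leafᵗ = op 0F []
  true  = op 2F []

  nodeᵗ _⊃_ : Term Sig X → Term Sig X → Term Sig X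
  nodeᵗ a b = op 1F (a ∷ b ∷ [])
  h ⊃ c     = op 3F (h ∷ c ∷ [])

  isTree holds : Term Sig X → Term Sig X
  isTree a = op 4F (a ∷ [])
  holds a  = op 5F (a ∷ [])

  infixr 5 _⊃_ _⊃*_

  _⊃*_ : List (Term Sig X) → Term Sig X → Term Sig X
  hs ⊃* c = List.foldr _⊃_ c hs

  embed : {V : Set} → (V → Term Sig X) → Tree V → Term Sig X
  embed ρ (var v)    = ρ v
  embed ρ leaf       = leafᵗ
  embed ρ (node a b) = nodeᵗ (embed ρ a) (embed ρ b)

  ⌜_⌝ : GroundTree → Term Sig X
  ⌜_⌝ = embed λ ()

  embed-inst : {V : Set} (σ : V → GroundTree) (p : Tree V) →
               ⌜ inst σ p ⌝ ≡ embed (⌜_⌝ ∘ σ) p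
  embed-inst σ (var v)    = refl
  embed-inst σ leaf       = refl
  embed-inst σ (node a b) = cong₂ nodeᵗ (embed-inst σ a) (embed-inst σ b)

inst-ground : (σ : ⊥ → GroundTree) (a : GroundTree) → inst σ a ≡ a
inst-ground σ leaf       = refl
inst-ground σ (node a b) = cong₂ node (inst-ground σ a) (inst-ground σ b)

sub-embed : {V X Y : Set} {σ : X → Term Sig Y} {ρ : V → Term Sig X}
            {ρ′ : V → Term Sig Y} → (∀ v → sub σ (ρ v) ≡ ρ′ v) →
            ∀ p → sub σ (embed ρ p) ≡ embed ρ′ p
sub-embed eq (var v)    = eq v
sub-embed eq leaf       = refl
sub-embed eq (node a b) = cong₂ nodeᵗ (sub-embed eq a) (sub-embed eq b)

sub-⊃* : {X Y : Set} (σ : X → Term Sig Y) (hs : List (Term Sig X))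
         (c : Term Sig X) → sub σ (hs ⊃* c) ≡ List.map (sub σ) hs ⊃* sub σ c
sub-⊃* σ []       c = refl
sub-⊃* σ (h ∷ hs) c = cong (sub σ h ⊃_) (sub-⊃* σ hs c)

guard : ∀ {k} → Fin k → Term Sig ℕ
guard = isTree ∘ var ∘ toℕ

pattern-term : ∀ {k} → Tree (Fin k) → Term Sig ℕ
pattern-term = embed (var ∘ toℕ)

-- The guards are needed because a variable of an equation may take a value that
-- is not a tree.
clauseHyps : (c : Clause) → List (Term Sig ℕ)
clauseHyps (clause k hs _) =
  List.map guard (List.allFin k) ++ List.map (holds ∘ pattern-term) hs

clauseEquation : Clause → Equation Sig
clauseEquation c =
  clauseHyps c ⊃* holds (pattern-term (Clause.concl c)) , true

module _ (program : List Clause) where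

  hornEquations : List (Equation Sig)
  hornEquations =
    (true ⊃ var 0 , var 0) ∷
    (isTree leafᵗ , true) ∷
    (isTree (var 0) ⊃ isTree (var 1) ⊃ isTree (nodeᵗ (var 0) (var 1)) , true) ∷
    List.map clauseEquation program

  -- Only the first equation depends on the goal; the code of the remaining list is a constant.
  hornPresentation : GroundTree → Presentation
  hornPresentation goal =
    ⟨ Sig ∣ (holds ⌜ goal ⌝ ⊃ var 0 , true) ∷ hornEquations ⟩

-- The variables of an equation range over all of ℕ, those of a clause over `Fin k`; the default `d`
-- fills the gap.
assign : {A : Set} {k : ℕ} → Vec A k → A → ℕ → A
assign []       d n       = d
assign (x ∷ xs) d zero    = x
assign (x ∷ xs) d (suc n) = assign xs d n

assign-toℕ : {A : Set} {k : ℕ} (xs : Vec A k) (d : A) (i : Fin k) →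
             assign xs d (toℕ i) ≡ Vec.lookup xs i
assign-toℕ (x ∷ xs) d zero    = refl
assign-toℕ (x ∷ xs) d (suc i) = assign-toℕ xs d i

-- Derivations from the equations, and collapse when the goal is derivable

module Derivation (program : List Clause) (goal : GroundTree) where

  P : Presentation
  P = hornPresentation program goal

  infix 4 _≈_
  _≈_ : Term Sig ⊤ → Term Sig ⊤ → Set
  _≈_ = _≋_ P 𝟙

  Provable : Term Sig ⊤ → Set
  Provable t = t ≈ true

  Derivable : Pred GroundTree 0ℓ
  Derivable a = Provable (holds ⌜ a ⌝)

  -- The chain is c = (`true` ⊃ c) = (h ⊃ c) = `true`; the middle step replaces `true` by the
  -- provable h.
  modus-ponens : ∀ {h c} → Provable h → Provable (h ⊃ c) → Provable c
  modus-ponens {h} {c} h≈ h⊃c≈ =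
    ≋-trans (≋-sym (≋-ax (there (here refl)) λ _ → c))
    (≋-trans (≋-op 3F (≋-sym h≈ ∷ ≋-refl ∷ [])) h⊃c≈)

  modus-ponens* : ∀ {hs c} → All Provable hs → Provable (hs ⊃* c) → Provable c
  modus-ponens* []       d = d
  modus-ponens* (p ∷ ps) d = modus-ponens* ps (modus-ponens p d)

  -- Discharges the guards in front of every clause.
  isTree-provable : ∀ a → Provable (isTree ⌜ a ⌝)
  isTree-provable leaf = ≋-ax (there (there (here refl))) λ _ → true
  isTree-provable (node a b) =
    modus-ponens (isTree-provable b) (modus-ponens (isTree-provable a)
      (≋-ax (there (there (there (here refl))))
        (assign (⌜ a ⌝ ∷ ⌜ b ⌝ ∷ []) true)))

  module _ {k : ℕ} (σ : Vec GroundTree k) where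

    private
      σᵗ : ℕ → Term Sig ⊤
      σᵗ = ⌜_⌝ ∘ assign σ leaf

    sub-pattern : ∀ p → sub σᵗ (pattern-term p) ≡ ⌜ inst (Vec.lookup σ) p ⌝
    sub-pattern p = trans
      (sub-embed (λ i → cong ⌜_⌝ (assign-toℕ σ leaf i)) p)
      (sym (embed-inst (Vec.lookup σ) p))

    guards-provable : (is : List (Fin k)) →
      All Provable (List.map (sub σᵗ) (List.map guard is))
    guards-provable []       = []
    guards-provable (i ∷ is) =
      isTree-provable (assign σ leaf (toℕ i)) ∷ guards-provable is

    hyps-provable : ∀ hs → All Derivable (List.map (inst (Vec.lookup σ)) hs) →
      All Provable (List.map (sub σᵗ) (List.map (holds ∘ pattern-term) hs))
    hyps-provable []       []       = []
    hyps-provable (h ∷ hs) (d ∷ ds) =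
      subst (Provable ∘ holds) (sym (sub-pattern h)) d ∷ hyps-provable hs ds

    derive : ∀ {hs c} → clause k hs c ∈ program →
             All Derivable (List.map (inst (Vec.lookup σ)) hs) →
             Derivable (inst (Vec.lookup σ) c)
    derive {hs} {c} c∈ ds =
      subst (Provable ∘ holds) (sub-pattern c)
        (modus-ponens*
          (subst (All Provable) (sym (map-++ (sub σᵗ) guards _))
            (All.++⁺ (guards-provable (List.allFin k)) (hyps-provable hs ds)))
          (subst Provable (sub-⊃* σᵗ (clauseHyps (clause k hs c)) _)
            (≋-ax (there (there (there (there (∈-map⁺ clauseEquation c∈))))) σᵗ)))
      where guards = List.map guard (List.allFin k)

  derivable-respects : All (Derivable RespectsClause_) program
  derivable-respects = All.tabulate λ c∈ σ → derive σ c∈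

  derivable⇒affine : Derivable goal → IsAffine (presentedMonad P)
  derivable⇒affine d = true , λ t →
    modus-ponens
      -- The goal has no variables, so the substitution in the axiom leaves its term unchanged.
      (subst (Provable ∘ holds) (sym (sub-embed (λ ()) goal)) d)
      (≋-ax (here refl) λ _ → t)

-- Elements are predicates on trees; the singletons stand for trees. A term is
-- true if it contains leaf, and h ⊃ c is cut down to c only where h is true, so
-- that h ⊃_ is constant as soon as h is false.
module Model (M : Pred GroundTree 0ℓ) where

  D : Set₁
  D = Pred GroundTree 0ℓ

  Is : D → GroundTree → Set
  Is A a = A ≗ₚ ｛ a ｝

  Is-unique : ∀ {A a b} → Is A a → Is A b → a ≡ b
  Is-unique A≐a A≐b = proj₁ A≐a (proj₂ A≐b refl)

  Is-resp : ∀ {A B a} → A ≗ₚ B → Is A a → Is B a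
  Is-resp A≐B = ≐-trans (≐-sym A≐B)

  -- The existential form is total on `D` without deciding whether the arguments stand for trees; if
  -- one of them does not, the value is empty.
  nodeᴰ : D → D → D
  nodeᴰ A B t = ∃₂ λ a b → Is A a × Is B b × node a b ≡ t

  Is-node : ∀ {A B a b} → Is A a → Is B b → Is (nodeᴰ A B) (node a b)
  Is-node A≐a B≐b =
    (λ { (_ , _ , A≐a′ , B≐b′ , refl) →
         cong₂ node (Is-unique A≐a A≐a′) (Is-unique B≐b B≐b′) }) ,
    (λ { refl → _ , _ , A≐a , B≐b , refl })

  -- The values of `isTree` and `holds` are constant predicates, so they equal `U` as soon as they
  -- contain `leaf`.
  opᴰ : (f : Symbol Sig) → Vec D (arity Sig f) → D
  opᴰ 0F []           = ｛ leaf ｝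
  opᴰ 1F (A ∷ B ∷ []) = nodeᴰ A B
  opᴰ 2F []           = U
  opᴰ 3F (A ∷ B ∷ []) = λ t → A leaf → B t
  opᴰ 4F (A ∷ [])     = λ _ → ∃ (Is A)
  opᴰ 5F (A ∷ [])     = λ _ → ∃ λ a → Is A a × M a

  -- The hypothesis is equality rather than inclusion because implication is antitone in its first
  -- argument. Symmetry then yields the converse inclusion.
  opᴰ-mono : ∀ f {As Bs : Vec D (arity Sig f)} → Pointwise _≗ₚ_ As Bs →
             ∀ {t} → opᴰ f As t → opᴰ f Bs t
  opᴰ-mono 0F []           = id
  opᴰ-mono 1F (A≐ ∷ B≐ ∷ []) (a , b , isA , isB , eq) =
    a , b , Is-resp A≐ isA , Is-resp B≐ isB , eq
  opᴰ-mono 2F []           = id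
  opᴰ-mono 3F (A≐ ∷ B≐ ∷ []) f = proj₁ B≐ ∘ f ∘ proj₂ A≐
  opᴰ-mono 4F (A≐ ∷ []) (a , isA) = a , Is-resp A≐ isA
  opᴰ-mono 5F (A≐ ∷ []) (a , isA , m) = a , Is-resp A≐ isA , m

  mutual
    eval : {X : Set} → (X → D) → Term Sig X → D
    eval ρ (var x)   = ρ x
    eval ρ (op f ts) = opᴰ f (evals ρ ts)

    evals : {X : Set} {n : ℕ} → (X → D) → Vec (Term Sig X) n → Vec D n
    evals ρ []       = []
    evals ρ (t ∷ ts) = eval ρ t ∷ evals ρ ts

  mutual
    eval-sub : {X Y : Set} (ρ : Y → D) (σ : X → Term Sig Y) (t : Term Sig X) →
               eval ρ (sub σ t) ≡ eval (eval ρ ∘ σ) t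
    eval-sub ρ σ (var x)   = refl
    eval-sub ρ σ (op f ts) = cong (opᴰ f) (evals-subs ρ σ ts)

    evals-subs : {X Y : Set} {n : ℕ} (ρ : Y → D) (σ : X → Term Sig Y)
                 (ts : Vec (Term Sig X) n) →
                 evals ρ (subs σ ts) ≡ evals (eval ρ ∘ σ) ts
    evals-subs ρ σ []       = refl
    evals-subs ρ σ (t ∷ ts) = cong₂ _∷_ (eval-sub ρ σ t) (evals-subs ρ σ ts)

  Is-embed : {V X : Set} {ρ : X → D} {τ : V → Term Sig X} {σ : V → GroundTree} →
             (∀ v → Is (eval ρ (τ v)) (σ v)) →
             ∀ p → Is (eval ρ (embed τ p)) (inst σ p)
  Is-embed is (var v)    = is v
  Is-embed is leaf       = ≐-refl
  Is-embed is (node a b) = Is-node (Is-embed is a) (Is-embed is b)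

  Valid : Equation Sig → Set₁
  Valid (l , r) = (ρ : ℕ → D) → eval ρ l ≗ₚ eval ρ r

  valid-⊃* : ∀ {ρ : ℕ → D} {c} hs →
             (All (λ h → eval ρ h leaf) hs → ∀ t → eval ρ c t) →
             ∀ t → eval ρ (hs ⊃* c) t
  valid-⊃* []       f t = f [] t
  valid-⊃* (h ∷ hs) f t = λ p → valid-⊃* hs (λ ps → f (p ∷ ps)) t

  module _ {ρ : ℕ → D} {k : ℕ} (σ : Vec GroundTree k)
           (is : ∀ i → Is (ρ (toℕ i)) (Vec.lookup σ i)) where

    hyps-in-M : ∀ hs →
      All (λ h → eval ρ h leaf) (List.map (holds ∘ pattern-term) hs) →
      All M (List.map (inst (Vec.lookup σ)) hs)
    hyps-in-M []       []       = []
    hyps-in-M (h ∷ hs) ((a , isA , m) ∷ ps) =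
      subst M (Is-unique isA (Is-embed is h)) m ∷ hyps-in-M hs ps

  -- True guards provide trees for which the variables stand, and the closure of `M` is applied to
  -- these trees.
  valid-clause : ∀ c → M RespectsClause c → Valid (clauseEquation c)
  valid-clause (clause k hs c) closed ρ =
    _ , λ {t} _ → valid-⊃* (clauseHyps (clause k hs c)) conclude t
    where
    guards = List.map guard (List.allFin k)

    conclude : All (λ h → eval ρ h leaf) (clauseHyps (clause k hs c)) →
               ∀ t → eval ρ (holds (pattern-term c)) t
    conclude ps t = _ , Is-embed is c ,
      closed σ (hyps-in-M σ is hs (All.++⁻ʳ guards ps))
      where
      trees : ∀ i → ∃ (Is (ρ (toℕ i)))
      trees = All.tabulate⁻ (All.map⁻ (All.++⁻ˡ guards ps))
      σ = Vec.tabulate (proj₁ ∘ trees)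
      is : ∀ i → Is (ρ (toℕ i)) (Vec.lookup σ i)
      is i = subst (Is (ρ (toℕ i))) (sym (lookup∘tabulate _ i)) (proj₂ (trees i))

  module _ (program : List Clause) (goal : GroundTree)
           (closed : All (M RespectsClause_) program) (¬goal : ¬ M goal) where

    private
      P : Presentation
      P = hornPresentation program goal

    goal-false : ∀ {ρ : ℕ → D} → ¬ eval ρ (holds ⌜ goal ⌝) leaf
    goal-false (a , isA , m) =
      ¬goal (subst M (trans (Is-unique isA (Is-embed {σ = λ ()} (λ ()) goal)) (inst-ground _ goal)) m)

    valid-equations : All Valid (Presentation.equations P)
    valid-equations =
      -- The premise `holds ⌜ goal ⌝` is false, so the implication is all of `U`.
      (λ ρ → _ , λ _ p → contradiction p (goal-false {ρ})) ∷
      (λ ρ → (λ f → f _) , λ p _ → p) ∷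
      (λ ρ → _ , λ _ → leaf , ≐-refl) ∷
      (λ ρ → _ , λ { _ (a , isA) (b , isB) → node a b , Is-node isA isB }) ∷
      All.map⁺ (All.map (λ {c} → valid-clause c) closed)

    private
      ρ : ⊤ → D
      ρ _ = U

    mutual
      eval-resp : ∀ {t u} → _≋_ P 𝟙 t u → eval ρ t ≗ₚ eval ρ u
      eval-resp (≋-var _)     = ≐-refl
      eval-resp (≋-op f ts≋us) =
        opᴰ-mono f (evals-resp ts≋us) , opᴰ-mono f (Pointwise.sym ≐-sym (evals-resp ts≋us))
      eval-resp (≋-ax {l} {r} l≈r σ)
        rewrite eval-sub ρ σ l | eval-sub ρ σ r =
        All.lookup valid-equations l≈r (eval ρ ∘ σ)
      eval-resp ≋-refl        = ≐-refl
      eval-resp (≋-sym p)     = ≐-sym (eval-resp p)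
      eval-resp (≋-trans p q) = ≐-trans (eval-resp p) (eval-resp q)

      evals-resp : ∀ {n} {ts us : Vec (Term Sig ⊤) n} →
                   Pointwise (_≋_ P 𝟙) ts us →
                   Pointwise _≗ₚ_ (evals ρ ts) (evals ρ us)
      evals-resp []       = []
      evals-resp (p ∷ ps) = eval-resp p ∷ evals-resp ps

    ¬affine : ¬ IsAffine (presentedMonad P)
    ¬affine (t , t-only)
      -- The value of `true` contains `node leaf leaf`, while that of `leafᵗ` contains only `leaf`.
      with () ← proj₂ (eval-resp (≋-trans (t-only leafᵗ) (≋-sym (t-only true))))
                  {node leaf leaf} _

-- A universal evaluator for partial recursive functions as a Horn program

-- Numbers, lists and programs are all binary trees. 0 is the empty list and
-- suc n the list with head 0 and tail n, so the successor is consᵖ nilᵖ headᵖ.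
-- minᵖ f maps k ∷ xs to the least zero j ≥ k of f (_ ∷ xs); the recursion is on
-- the starting point k.
pattern nilᵖ      = leaf
pattern idᵖ       = node leaf leaf
pattern headᵖ     = node leaf (node leaf leaf)
pattern tailᵖ p   = node (node leaf leaf) p
pattern compᵖ f g = node (node leaf (node leaf leaf)) (node f g)
pattern consᵖ f g = node (node leaf (node leaf (node leaf leaf))) (node f g)
pattern primᵖ f g = node (node (node leaf leaf) leaf) (node f g)
pattern minᵖ f    = node (node (node leaf leaf) (node leaf leaf)) f

pattern sucᵛ n    = node leaf n

infix 6 _[_]↦_
pattern _[_]↦_ p xs y = node p (node xs y)

infixr 7 _∷ᵛ_
pattern _∷ᵛ_ x xs = node x xs

evaluator : List Clause
evaluator =
  clause 1 [] (nilᵖ [ v0 ]↦ leaf) ∷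
  clause 1 [] (idᵖ [ v0 ]↦ v0) ∷
  clause 2 [] (headᵖ [ v0 ∷ᵛ v1 ]↦ v0) ∷
  clause 4 (v0 [ v1 ]↦ v2 ∷ [])
    (tailᵖ v0 [ v3 ∷ᵛ v1 ]↦ v2) ∷
  clause 5 (v1 [ v2 ]↦ v3 ∷ v0 [ v3 ]↦ v4 ∷ [])
    (compᵖ v0 v1 [ v2 ]↦ v4) ∷
  clause 5 (v0 [ v2 ]↦ v3 ∷ v1 [ v2 ]↦ v4 ∷ [])
    (consᵖ v0 v1 [ v2 ]↦ v3 ∷ᵛ v4) ∷
  clause 4 (v0 [ v2 ]↦ v3 ∷ [])
    (primᵖ v0 v1 [ leaf ∷ᵛ v2 ]↦ v3) ∷
  clause 6 (primᵖ v0 v1 [ v3 ∷ᵛ v2 ]↦ v4 ∷ v1 [ v3 ∷ᵛ v4 ∷ᵛ v2 ]↦ v5 ∷ [])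
    (primᵖ v0 v1 [ sucᵛ v3 ∷ᵛ v2 ]↦ v5) ∷
  clause 3 (v0 [ v2 ∷ᵛ v1 ]↦ leaf ∷ [])
    (minᵖ v0 [ v2 ∷ᵛ v1 ]↦ v2) ∷
  clause 5 (v0 [ v2 ∷ᵛ v1 ]↦ sucᵛ v3 ∷ minᵖ v0 [ sucᵛ v2 ∷ᵛ v1 ]↦ v4 ∷ [])
    (minᵖ v0 [ v2 ∷ᵛ v1 ]↦ v4) ∷
  []
  where
  pattern v0 = var 0F
  pattern v1 = var 1F
  pattern v2 = var 2F
  pattern v3 = var 3F
  pattern v4 = var 4F
  pattern v5 = var 5F

private variable
  f g xs ys x y z k j : GroundTree

-- The least set of atoms closed under `evaluator`, with one constructor per clause so that
-- derivations can be analysed by cases.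
data Eval : Pred GroundTree 0ℓ where
  eval-nil  : Eval (nilᵖ [ xs ]↦ leaf)
  eval-id   : Eval (idᵖ [ xs ]↦ xs)
  eval-head : Eval (headᵖ [ x ∷ᵛ xs ]↦ x)
  eval-tail : Eval (f [ xs ]↦ y) → Eval (tailᵖ f [ x ∷ᵛ xs ]↦ y)
  eval-comp : Eval (g [ xs ]↦ ys) → Eval (f [ ys ]↦ z) →
              Eval (compᵖ f g [ xs ]↦ z)
  eval-cons : Eval (f [ xs ]↦ y) → Eval (g [ xs ]↦ ys) →
              Eval (consᵖ f g [ xs ]↦ y ∷ᵛ ys)
  eval-base : Eval (f [ xs ]↦ y) → Eval (primᵖ f g [ leaf ∷ᵛ xs ]↦ y)
  eval-step : Eval (primᵖ f g [ k ∷ᵛ xs ]↦ y) →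
              Eval (g [ k ∷ᵛ y ∷ᵛ xs ]↦ z) →
              Eval (primᵖ f g [ sucᵛ k ∷ᵛ xs ]↦ z)
  eval-stop : Eval (f [ k ∷ᵛ xs ]↦ leaf) → Eval (minᵖ f [ k ∷ᵛ xs ]↦ k)
  eval-next : Eval (f [ k ∷ᵛ xs ]↦ sucᵛ y) →
              Eval (minᵖ f [ sucᵛ k ∷ᵛ xs ]↦ j) →
              Eval (minᵖ f [ k ∷ᵛ xs ]↦ j)

eval-respects : All (Eval RespectsClause_) evaluator
eval-respects =
  (λ { (_ ∷ []) [] → eval-nil }) ∷
  (λ { (_ ∷ []) [] → eval-id }) ∷
  (λ { (_ ∷ _ ∷ []) [] → eval-head }) ∷
  (λ { (_ ∷ _ ∷ _ ∷ _ ∷ []) (p ∷ []) → eval-tail p }) ∷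
  (λ { (_ ∷ _ ∷ _ ∷ _ ∷ _ ∷ []) (p ∷ q ∷ []) → eval-comp p q }) ∷
  (λ { (_ ∷ _ ∷ _ ∷ _ ∷ _ ∷ []) (p ∷ q ∷ []) → eval-cons p q }) ∷
  (λ { (_ ∷ _ ∷ _ ∷ _ ∷ []) (p ∷ []) → eval-base p }) ∷
  (λ { (_ ∷ _ ∷ _ ∷ _ ∷ _ ∷ _ ∷ []) (p ∷ q ∷ []) → eval-step p q }) ∷
  (λ { (_ ∷ _ ∷ _ ∷ []) (p ∷ []) → eval-stop p }) ∷
  (λ { (_ ∷ _ ∷ _ ∷ _ ∷ _ ∷ []) (p ∷ q ∷ []) → eval-next p q }) ∷
  []

-- Program tags are distinct, so program and input determine the last rule, except for `minᵖ`. Its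
-- two rules exclude each other, since the value of f at k would be both zero and a successor.
eval-functional : Eval (f [ xs ]↦ y) → Eval (f [ xs ]↦ z) → y ≡ z
eval-functional eval-nil        eval-nil        = refl
eval-functional eval-id         eval-id         = refl
eval-functional eval-head       eval-head       = refl
eval-functional (eval-tail p)   (eval-tail q)   = eval-functional p q
eval-functional (eval-comp p q) (eval-comp p′ q′)
  with refl ← eval-functional p p′ = eval-functional q q′
eval-functional (eval-cons p q) (eval-cons p′ q′) =
  cong₂ node (eval-functional p p′) (eval-functional q q′)
eval-functional (eval-base p)   (eval-base q)   = eval-functional p q
eval-functional (eval-step p q) (eval-step p′ q′)
  with refl ← eval-functional p p′ = eval-functional q q′
eval-functional (eval-stop p)   (eval-stop q)   = refl
eval-functional (eval-stop p)   (eval-next q _)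
  with () ← eval-functional p q
eval-functional (eval-next p _) (eval-stop q)
  with () ← eval-functional p q
eval-functional (eval-next _ p) (eval-next _ q) = eval-functional p q

-- Compiling partial recursive functions to list programs

numeral : ℕ → GroundTree
numeral zero    = leaf
numeral (suc n) = sucᵛ (numeral n)

arguments : ∀ {n} → Vec ℕ n → GroundTree
arguments []       = leaf
arguments (x ∷ xs) = numeral x ∷ᵛ arguments xs

projection : ∀ {n} → Fin n → GroundTree
projection zero    = headᵖ
projection (suc i) = tailᵖ (projection i)

mutual
  compile : ∀ {n} → Rec n → GroundTree
  compile zeroʳ        = nilᵖ
  compile sucʳ         = consᵖ nilᵖ headᵖ
  compile (projʳ i)    = projection i
  compile (compʳ f gs) = compᵖ (compile f) (compileAll gs)
  compile (primʳ f g)  = primᵖ (compile f) (compile g)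
  -- `consᵖ nilᵖ idᵖ` puts 0 in front of the arguments, so the search starts at 0.
  compile (minʳ f)     = compᵖ (minᵖ (compile f)) (consᵖ nilᵖ idᵖ)

  compileAll : ∀ {m n} → Vec (Rec n) m → GroundTree
  compileAll []       = nilᵖ
  compileAll (g ∷ gs) = consᵖ (compile g) (compileAll gs)

-- An arbitrary closed `M` covers both uses: the derivable atoms and `Eval`.
compile-correct : (M : Pred GroundTree 0ℓ) → All (M RespectsClause_) evaluator →
                  ∀ {n} {f : Rec n} {xs y} → f [ xs ]⇓ y →
                  M (compile f [ arguments xs ]↦ numeral y)
compile-correct M
  (nil ∷ ident ∷ head ∷ tail ∷ comp ∷ cons ∷ base ∷ step ∷ stop ∷ next ∷ []) = run
  where
  run-proj : ∀ {n} (i : Fin n) xs →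
             M (projection i [ arguments xs ]↦ numeral (Vec.lookup xs i))
  run-proj zero    (x ∷ xs) = head (_ ∷ _ ∷ []) []
  run-proj (suc i) (x ∷ xs) = tail (_ ∷ _ ∷ _ ∷ _ ∷ []) (run-proj i xs ∷ [])

  -- Induction on the distance d from the candidate j to the least zero k.
  search : ∀ {f xs k} →
           (∀ j → j < k → ∃ λ y → M (f [ numeral j ∷ᵛ xs ]↦ sucᵛ y)) →
           M (f [ numeral k ∷ᵛ xs ]↦ leaf) →
           ∀ d j → d + j ≡ k → M (minᵖ f [ numeral j ∷ᵛ xs ]↦ numeral k)
  search below at zero    j refl = stop (_ ∷ _ ∷ _ ∷ []) (at ∷ [])
  search below at (suc d) j refl =
    next (_ ∷ _ ∷ _ ∷ _ ∷ _ ∷ [])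
      (proj₂ (below j (s≤s (m≤n+m j d))) ∷
       search below at d (suc j) (+-suc d j) ∷ [])

  mutual
    run : ∀ {n} {f : Rec n} {xs y} → f [ xs ]⇓ y →
          M (compile f [ arguments xs ]↦ numeral y)
    run ⇓-zero = nil (_ ∷ []) []
    run ⇓-suc  =
      cons (_ ∷ _ ∷ _ ∷ _ ∷ _ ∷ []) (nil (_ ∷ []) [] ∷ head (_ ∷ _ ∷ []) [] ∷ [])
    run (⇓-proj {i = i} {xs}) = run-proj i xs
    run (⇓-comp ps q) = comp (_ ∷ _ ∷ _ ∷ _ ∷ _ ∷ []) (runAll ps ∷ run q ∷ [])
    run (⇓-base p)    = base (_ ∷ _ ∷ _ ∷ _ ∷ []) (run p ∷ [])
    run (⇓-step p q)  = step (_ ∷ _ ∷ _ ∷ _ ∷ _ ∷ _ ∷ []) (run p ∷ run q ∷ [])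
    run (⇓-min {k = k} ps q) =
      comp (_ ∷ _ ∷ _ ∷ _ ∷ _ ∷ [])
        (cons (_ ∷ _ ∷ _ ∷ _ ∷ _ ∷ []) (nil (_ ∷ []) [] ∷ ident (_ ∷ []) [] ∷ []) ∷
         search (λ j j<k → run-positive (ps j j<k)) (run q) k 0 (+-identityʳ k) ∷ [])

    run-positive : ∀ {n} {f : Rec n} {xs} → (∃ λ y → f [ xs ]⇓ suc y) →
                   ∃ λ y → M (compile f [ arguments xs ]↦ sucᵛ y)
    run-positive (y , p) = numeral y , run p

    runAll : ∀ {m n} {gs : Vec (Rec n) m} {xs ys} →
             Pointwise (λ g y → g [ xs ]⇓ y) gs ys →
             M (compileAll gs [ arguments xs ]↦ arguments ys)
    runAll []       = nil (_ ∷ []) []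
    runAll (p ∷ ps) = cons (_ ∷ _ ∷ _ ∷ _ ∷ _ ∷ []) (run p ∷ runAll ps ∷ [])

returnsZero : GroundTree → ℕ → GroundTree
returnsZero f n = f [ arguments (n ∷ []) ]↦ leaf

evaluatorPresentation : GroundTree → Presentation
evaluatorPresentation = hornPresentation evaluator

zero⇒affine : ∀ {f n} → f [ n ∷ [] ]⇓ 0 →
  IsAffine (presentedMonad (evaluatorPresentation (returnsZero (compile f) n)))
zero⇒affine {f} {n} p =
  derivable⇒affine (compile-correct Derivable derivable-respects p)
  where open Derivation evaluator (returnsZero (compile f) n)

-- `Eval` contains the atom with value 1, so by functionality it misses the goal and yields a
-- nontrivial model.
one⇒¬affine : ∀ {f n} → f [ n ∷ [] ]⇓ 1 →
  ¬ IsAffine (presentedMonad (evaluatorPresentation (returnsZero (compile f) n)))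
one⇒¬affine {f} {n} p =
  Model.¬affine Eval evaluator (returnsZero (compile f) n) eval-respects ¬zero
  where
  ¬zero : ¬ Eval (returnsZero (compile f) n)
  ¬zero q with () ← eval-functional q (compile-correct Eval eval-respects p)

-- Computing codes

constant : ∀ {n} → ℕ → Rec n
constant zero    = zeroʳ
constant (suc c) = compʳ sucʳ (constant c ∷ [])

constant-correct : ∀ {n} {xs : Vec ℕ n} c → constant c [ xs ]⇓ c
constant-correct zero    = ⇓-zero
constant-correct (suc c) = ⇓-comp (constant-correct c ∷ []) ⇓-suc

double : Rec 1
double = primʳ zeroʳ (compʳ sucʳ (compʳ sucʳ (projʳ 1F ∷ []) ∷ []))

double-correct : ∀ n → double [ n ∷ [] ]⇓ 2 * n
double-correct zero    = ⇓-base ⇓-zero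
double-correct (suc n) = subst (double [ suc n ∷ [] ]⇓_) (sym (*-suc 2 n))
  (⇓-step (double-correct n) (⇓-comp (⇓-comp (⇓-proj ∷ []) ⇓-suc ∷ []) ⇓-suc))

-- Recursion on a in 2 ^ a * (2b + 1): the base is 2b + 1 and every step doubles the previous value.
pairing : Rec 2
pairing = primʳ (compʳ sucʳ (double ∷ [])) (compʳ double (projʳ 1F ∷ []))

pairing-correct : ∀ a b → pairing [ a ∷ b ∷ [] ]⇓ pair a b
pairing-correct zero    b = subst (pairing [ 0 ∷ b ∷ [] ]⇓_)
  (sym (*-identityˡ (suc (2 * b))))
  (⇓-base (⇓-comp (double-correct b ∷ []) ⇓-suc))
pairing-correct (suc a) b = subst (pairing [ suc a ∷ b ∷ [] ]⇓_)
  (sym (*-assoc 2 (2 ^ a) (suc (2 * b))))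
  (⇓-step (pairing-correct a b) (⇓-comp (⇓-proj ∷ []) (double-correct (pair a b))))

-- A record indexed by the coded objects, because type checking must not compare
-- their codes, which are far too large.
record ComputesCode {I A : Set} {n : ℕ} (input : I → Vec ℕ n)
                    (c : A → ℕ) (x : I → A) : Set where
  field
    program : Rec n
    correct : ∀ i → program [ input i ]⇓ c (x i)

open ComputesCode

module _ {I : Set} {n : ℕ} {input : I → Vec ℕ n} where

  constant-code : {A : Set} {c : A → ℕ} (x : A) →
                  ComputesCode input c (λ _ → x)
  constant-code {c = c} x = record
    { program = constant (c x) ; correct = λ _ → constant-correct (c x) }

  -- Compound syntax is coded by `pair`, so each constructor below is an instance whose equation
  -- between codes is reflexivity.
  pair-code : {A B C : Set} {c : A → ℕ} {d : B → ℕ} {e : C → ℕ}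
    (_∙_ : A → B → C) → (∀ a b → pair (c a) (d b) ≡ e (a ∙ b)) →
    {x : I → A} {y : I → B} →
    ComputesCode input c x → ComputesCode input d y →
    ComputesCode input e (λ i → x i ∙ y i)
  pair-code _∙_ e-∙ {x} {y} p q = record
    { program = compʳ pairing (program p ∷ program q ∷ [])
    ; correct = λ i → subst (_ [ input i ]⇓_) (e-∙ (x i) (y i))
        (⇓-comp (correct p i ∷ correct q i ∷ []) (pairing-correct _ _))
    }

  module _ {S : Signature} where

    op-code : (f : Symbol S) {ts : I → Vec (Term S ℕ) (arity S f)} →
              ComputesCode input codeTerms ts →
              ComputesCode input codeTerm (λ i → op f (ts i))
    -- The symbol is fixed, so its number enters as the code of the unit element.
    op-code f = pair-code {c = λ _ → suc (toℕ f)} (λ _ → op f) (λ _ _ → refl)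
      (constant-code tt)

    terms-code : ∀ {k} {t : I → Term S ℕ} {ts : I → Vec (Term S ℕ) k} →
                 ComputesCode input codeTerm t → ComputesCode input codeTerms ts →
                 ComputesCode input codeTerms (λ i → t i ∷ ts i)
    terms-code = pair-code _∷_ λ _ _ → refl

    equation-code : {l r : I → Term S ℕ} →
      ComputesCode input codeTerm l → ComputesCode input codeTerm r →
      ComputesCode input codeEquation (λ i → l i , r i)
    equation-code = pair-code _,_ λ _ _ → refl

    equations-code : {e : I → Equation S} {es : I → List (Equation S)} →
      ComputesCode input codeEquation e →
      ComputesCode input (codeList codeEquation) es →
      ComputesCode input (codeList codeEquation) (λ i → e i ∷ es i)
    equations-code = pair-code _∷_ λ _ _ → refl

    presentation-code : {E : I → List (Equation S)} →
      ComputesCode input (codeList codeEquation) E →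
      ComputesCode input codePresentation (λ i → ⟨ S ∣ E i ⟩)
    presentation-code = pair-code {c = λ _ → codeList id S} (λ _ → ⟨ S ∣_⟩)
      (λ _ _ → refl) (constant-code tt)

  node-code : {t u : I → Term Sig ℕ} →
    ComputesCode input codeTerm t → ComputesCode input codeTerm u →
    ComputesCode input codeTerm (λ i → nodeᵗ (t i) (u i))
  node-code p q = op-code 1F (terms-code p (terms-code q (constant-code [])))

-- Quotation of numbers, by primitive recursion: the code of each numeral is computed from that of
-- its predecessor.
numeral-code : ComputesCode (_∷ []) (codeTerm {Sig}) (⌜_⌝ ∘ numeral)
numeral-code = record { program = primʳ (program base) (program step) ; correct = run }
  where
  base : ComputesCode {ℕ} (λ _ → []) (codeTerm {Sig}) (λ _ → leafᵗ)
  base = constant-code leafᵗ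

  step : ComputesCode (λ n → n ∷ codeTerm {Sig} ⌜ numeral n ⌝ ∷ [])
           (codeTerm {Sig}) (λ n → ⌜ numeral (suc n) ⌝)
  step = node-code (constant-code leafᵗ)
    (record { program = projʳ 1F ; correct = λ _ → ⇓-proj })

  run : ∀ n → primʳ (program base) (program step) [ n ∷ [] ]⇓
              codeTerm {Sig} ⌜ numeral n ⌝
  run zero    = ⇓-base (correct base 0)
  run (suc n) = ⇓-step (run n) (correct step n)

-- Diagonalisation: a program run on its own code

code : GroundTree → ℕ
code a = codeTerm {Sig} ⌜ a ⌝

diagonalPresentation : GroundTree → Presentation
diagonalPresentation a = evaluatorPresentation (returnsZero a (code a))

-- The program occurs in the goal twice: as a term, whose code is the input itself, and as the
-- numeral of that code, which has to be quoted.
diagonal-code :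
  ComputesCode (λ a → code a ∷ []) codePresentation diagonalPresentation
diagonal-code =
  presentation-code
    (equations-code
      (equation-code
        (op-code 3F (terms-code
          (op-code 5F (terms-code
            -- The goal tree: the program, its one-element argument list, and the output 0.
            (node-code self
              (node-code (node-code quoted (constant-code leafᵗ))
                (constant-code leafᵗ)))
            (constant-code [])))
          (constant-code (var 0 ∷ []))))
        (constant-code true))
      (constant-code (hornEquations evaluator)))
  where
  self : ComputesCode (λ a → code a ∷ []) (codeTerm {Sig}) ⌜_⌝
  self = record { program = projʳ 0F ; correct = λ _ → ⇓-proj }

  quoted : ComputesCode (λ a → code a ∷ []) (codeTerm {Sig}) (⌜_⌝ ∘ numeral ∘ code)
  quoted = record
    { program = program numeral-code
    ; correct = correct numeral-code ∘ code
    }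

-- If f passes the code of its own diagonal presentation to decide, then that
-- presentation is affine iff decide says that it is not.
diagonal-contradiction : ∀ {decide} (f : Rec 1) →
  (∀ {y} → decide [ codePresentation (diagonalPresentation (compile f)) ∷ [] ]⇓ y →
           f [ code (compile f) ∷ [] ]⇓ y) →
  ¬ Decides codePresentation decide (λ P → IsAffine (presentedMonad P))
diagonal-contradiction f runs decides =
  ¬affine (zero⇒affine (runs (proj₂ (decides P) ¬affine)))
  where
  P : Presentation
  P = diagonalPresentation (compile f)

  ¬affine : ¬ IsAffine (presentedMonad P)
  ¬affine affine = one⇒¬affine (runs (proj₁ (decides P) affine)) affine

compose-correct : {I A : Set} {n : ℕ} {input : I → Vec ℕ n} {c : A → ℕ}
  {x : I → A} (p : ComputesCode input c x) (f : Rec 1) (i : I) →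
  ∀ {y} → f [ c (x i) ∷ [] ]⇓ y → compʳ f (program p ∷ []) [ input i ]⇓ y
compose-correct p f i = ⇓-comp (correct p i ∷ [])

theorem4 : Undecidable codePresentation (λ P → IsAffine (presentedMonad P))
theorem4 (decide , decides) = diagonal-contradiction self
  (compose-correct diagonal-code decide (compile self)) decides
  where
  self : Rec 1
  self = compʳ decide (program diagonal-code ∷ [])
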